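{- Let $\Delta\ge 1$ and $s\ge 1$ be integers, $r=s\Delta$, and let $\sigma=(\Delta,\Delta,\ldots,\Delta)$ be the partition of $r$ into $s$ parts all equal to $\Delta$. Let $n\ge (r+1)^2$ and $q\ge r\Delta$, and let $H=H(n,r,q\mid\sigma)$. Then \[\nu(H)=\left\lfloor \frac{n\,(q-(q \bmod \Delta))}{r}\right\rfloor,\] where $q\bmod\Delta$ denotes the remainder of $q$ upon division by $\Delta$.
   Context: A $\sigma$-hypergraph $H=H(n,r,q\mid\sigma)$, for a partition $\sigma=(a_1,\ldots,a_s)$ of $r$, is the $r$-uniform hypergraph whose vertex set is the disjoint union of $n$ classes $V_1,\ldots,V_n$, each of size $q$; an $r$-subset $K$ of vertices is an edge iff the multiset of non-zero values $|K\cap V_i|$ ($1\le i\le n$) equals $\sigma$. A matching is a set of pairwise vertex-disjoint edges; $\nu(H)$ is the maximum size of a matching in $H$. -}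

module Defs where

open import Data.Fin using (Fin; quotient)
import Data.Fin.Properties as Fin
open import Data.Fin.Subset using (Subset; ∣_∣; _∩_; Empty)
open import Data.List using (List; length; map; filter; replicate; allFin)
open import Data.List.Relation.Binary.Permutation.Propositional using (_↭_)
open import Data.List.Relation.Unary.All using (All)
import Data.List.Relation.Unary.All.Properties as All
open import Data.List.Relation.Unary.AllPairs using (AllPairs)
open import Data.List.Relation.Unary.Unique.Propositional using (Unique)
open import Data.Nat using (ℕ; zero; suc; _+_; _*_; _≤_; _≟_; NonZero; >-nonZero⁻¹)
open import Data.Nat.ListAction using (sum)
open import Data.Product using (_×_; proj₁; ∃-syntax)
open import Data.Vec using (tabulate)
open import Relation.Binary.PropositionalEquality using (_≡_; refl; cong)
open import Relation.Nullary using (does; ¬?)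

record UniformHypergraph (r : ℕ) : Set₁ where
  field
    order   : ℕ
    Edge    : Subset order → Set
    uniform : ∀ {K} → Edge K → ∣ K ∣ ≡ r

module _ {r : ℕ} (H : UniformHypergraph r) where
  open UniformHypergraph H

  -- The list M, being duplicate-free, stands for a finite set of edges whose
  -- cardinality is length M.
  record IsMatching (M : List (Subset order)) : Set where
    field
      edges    : All Edge M
      distinct : Unique M
      disjoint : AllPairs (λ K L → Empty (K ∩ L)) M

  -- IsMatchingNumber k says ν(H) = k.
  record IsMatchingNumber (k : ℕ) : Set where
    field
      attained : ∃[ M ] (IsMatching M × length M ≡ k)
      maximal  : ∀ M → IsMatching M → length M ≤ k

-- The order of the parts is immaterial: parts are only ever compared up to _↭_.
record Partition (r : ℕ) : Set where
  field
    parts    : List ℕ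
    positive : All (1 ≤_) parts
    total    : sum parts ≡ r

-- Vertices are Fin (n * q) ≅ Fin n × Fin q (via remQuot), and class i consists
-- of the q vertices whose first coordinate is i.
class : ∀ n q → Fin n → Subset (n * q)
class n q i = tabulate (λ v → does (quotient q v Fin.≟ i))

nonZeroIntersections : ∀ n q → Subset (n * q) → List ℕ
nonZeroIntersections n q K =
  filter (λ k → ¬? (k ≟ 0)) (map (λ i → ∣ K ∩ class n q i ∣) (allFin n))

σ-hypergraph : ∀ n r q → Partition r → UniformHypergraph r
σ-hypergraph n r q σ = record
  { order   = n * q
  ; Edge    = λ K → ∣ K ∣ ≡ r × nonZeroIntersections n q K ↭ Partition.parts σ
  ; uniform = proj₁
  }

sum-replicate : ∀ s Δ → sum (replicate s Δ) ≡ s * Δ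
sum-replicate zero    Δ = refl
sum-replicate (suc s) Δ = cong (Δ +_) (sum-replicate s Δ)

equalParts : ∀ s Δ .{{_ : NonZero Δ}} → Partition (s * Δ)
equalParts s Δ = record
  { parts    = replicate s Δ
  ; positive = All.replicate⁺ s (>-nonZero⁻¹ Δ)
  ; total    = sum-replicate s Δ
  }

{-# OPTIONS --safe #-}

-- Write m = ⌊q/Δ⌋, so that q − (q mod Δ) = mΔ.
--
-- Upper bound: the traces of the edges of a matching on one class are disjoint
-- and of size 0 or Δ, so their total size is a multiple of Δ that is at most q,
-- hence at most mΔ. Summing over the classes gives r·|M| ≤ n·mΔ.
--
-- Lower bound: cut each class into m blocks of Δ vertices (leaving q mod Δ
-- vertices unused) and number the l-th block of class i by n·l + i. For
-- j < ⌊mn/s⌋ the blocks numbered js, …, js + s − 1 form an edge: as s ≤ n,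
-- these consecutive numbers are distinct modulo n, so the blocks lie in
-- distinct classes.
module Submission where

open import Defs
import Algebra.Properties.Semiring.Sum
open import Data.Bool using (Bool; true; false; _∧_)
open import Data.Fin as Fin using (Fin; zero; suc; toℕ; combine; quotient; remainder; _↑ˡ_; _↑ʳ_)
import Data.Fin.Properties as Fin
open import Data.Fin.Subset using (Subset; ∣_∣; _∩_; ∁; ⊤; Empty; _∈_; inside; outside)
open import Data.Fin.Subset.Properties using (Empty-unique; ∣⊥∣≡0; ∩-idem; ∩-identityˡ; x∈p∩q⁻)
open import Data.List as List using (List; []; _∷_; length; replicate; allFin; filter)
import Data.List.Properties as List
open import Data.List.Membership.Propositional.Properties using (∈-lookup)
open import Data.List.Relation.Binary.Permutation.Propositional using (↭-sym; ↭-reflexive)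
open import Data.List.Relation.Binary.Permutation.Propositional.Properties using (All-resp-↭)
open import Data.List.Relation.Unary.All as All using (All; []; _∷_)
import Data.List.Relation.Unary.All.Properties as All
open import Data.List.Relation.Unary.AllPairs using (AllPairs; []; _∷_)
import Data.List.Relation.Unary.AllPairs.Properties as AllPairs
open import Data.Nat using (ℕ; zero; suc; _+_; _*_; _∸_; _^_; _≤_; _<_; _≥_; z≤n; _/_; _%_; _≟_; NonZero; ≢-nonZero⁻¹; >-nonZero)
open import Data.Nat.DivMod
open import Data.Nat.Divisibility using (_∣_; n∣m*n; ∣-refl; _∣0; ∣m∣n⇒∣m+n)
import Data.Nat.ListAction as ListAction
open import Data.Nat.Properties
open import Data.Product using (_,_; proj₁; proj₂)
open import Data.Sum using (_⊎_; inj₁; inj₂)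
open import Data.Vec using ([]; _∷_; here; there; lookup; tabulate)
open import Data.Vec.Properties using (lookup∘tabulate; lookup-zipWith; []=⇒lookup)
open import Function using (_∘_)
open import Relation.Binary.Definitions using (tri<; tri≈; tri>)
open import Relation.Binary.PropositionalEquality using (_≡_; _≢_; refl; sym; trans; cong; cong₂; module ≡-Reasoning)
open import Relation.Nullary using (Dec; does; yes; no; ¬?; contradiction)
open import Relation.Nullary.Decidable using (dec-true; dec-false)
open import Relation.Unary using (Pred; Decidable)

open Algebra.Properties.Semiring.Sum +-*-semiring using (sum; sum-syntax; sum-cong-≗; sum-remove; ∑-comm; *-distribˡ-sum)

private
  variable
    m n : ℕ

-- Sums over Fin

sum-const : ∀ n x → ∑[ i < n ] x ≡ n * x
sum-const zero    x = refl
sum-const (suc n) x = cong (x +_) (sum-const n x)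

sum-zero : {f : Fin n → ℕ} → (∀ i → f i ≡ 0) → sum f ≡ 0
sum-zero {n} f≡0 = trans (sum-cong-≗ f≡0) (trans (sum-const n 0) (*-zeroʳ n))

sum-mono-≤ : {f g : Fin n → ℕ} → (∀ i → f i ≤ g i) → sum f ≤ sum g
sum-mono-≤ {zero}  f≤g = z≤n
sum-mono-≤ {suc n} f≤g = +-mono-≤ (f≤g zero) (sum-mono-≤ (f≤g ∘ suc))

∣-sum : ∀ {d} {f : Fin n → ℕ} → (∀ i → d ∣ f i) → d ∣ sum f
∣-sum {zero}  d∣f = _ ∣0
∣-sum {suc n} d∣f = ∣m∣n⇒∣m+n (d∣f zero) (∣-sum (d∣f ∘ suc))

sum-split : ∀ m (f : Fin (m + n) → ℕ) →
            sum f ≡ ∑[ i < m ] f (i ↑ˡ n) + ∑[ j < n ] f (m ↑ʳ j)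
sum-split zero    f = refl
sum-split (suc m) f = trans (cong (f zero +_) (sum-split m (f ∘ suc))) (sym (+-assoc (f zero) _ _))

sum-combine : (f : Fin (m * n) → ℕ) → sum f ≡ ∑[ i < m ] ∑[ j < n ] f (combine i j)
sum-combine {zero}      f = refl
sum-combine {suc m} {n} f = trans (sum-split n f) (cong (sum (λ j → f (j ↑ˡ m * n)) +_) (sum-combine {m} (λ v → f (n ↑ʳ v))))

-- The quotient by `d` takes each value below `q / d` exactly `d` times and the value `q / d` on the
-- remaining `q % d` numbers. It serves both for cutting a class into blocks and for gathering block
-- numbers into groups.
sum-quotient : ∀ q d .{{_ : NonZero d}} (f : ℕ → ℕ) →
               ∑[ p < q ] f (toℕ p / d) ≡ d * ∑[ l < q / d ] f (toℕ l) + q % d * f (q / d)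
sum-quotient q d f = begin
  ∑[ p < q ] f (toℕ p / d)
    -- The summand sees `p` only through `toℕ p`, so the bound can be rewritten without casting `p`.
    ≡⟨ cong (λ N → ∑[ p < N ] f (toℕ p / d)) (trans (m≡m%n+[m/n]*n q d) (+-comm ρ (k * d))) ⟩
  ∑[ p < k * d + ρ ] f (toℕ p / d)
    ≡⟨ sum-split (k * d) _ ⟩
  ∑[ p < k * d ] f (toℕ (p ↑ˡ ρ) / d) + ∑[ u < ρ ] f (toℕ (k * d ↑ʳ u) / d)
    ≡⟨ cong₂ _+_ full rest ⟩
  d * ∑[ l < k ] f (toℕ l) + ρ * f k
    ∎
  where
  open ≡-Reasoning
  k = q / d
  ρ = q % d

  [l*d+u]/d≡l : ∀ l {u} → u < d → (l * d + u) / d ≡ l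
  [l*d+u]/d≡l l {u} u<d = begin
    (l * d + u) / d    ≡⟨ +-distrib-/-∣ˡ u (n∣m*n l) ⟩
    l * d / d + u / d  ≡⟨ cong₂ _+_ (m*n/n≡m l d) (m<n⇒m/n≡0 u<d) ⟩
    l + 0              ≡⟨ +-identityʳ l ⟩
    l                  ∎

  full : ∑[ p < k * d ] f (toℕ (p ↑ˡ ρ) / d) ≡ d * ∑[ l < k ] f (toℕ l)
  full = begin
    ∑[ p < k * d ] f (toℕ (p ↑ˡ ρ) / d)
      ≡⟨ sum-cong-≗ {k * d} (λ p → cong (λ t → f (t / d)) (Fin.toℕ-↑ˡ p ρ)) ⟩
    ∑[ p < k * d ] f (toℕ p / d)
      ≡⟨ sum-combine {k} _ ⟩
    ∑[ l < k ] ∑[ u < d ] f (toℕ (combine l u) / d)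
      ≡⟨ sum-cong-≗ {k} (λ l → sum-cong-≗ {d} (λ u → cong f (trans
           (/-congˡ (trans (Fin.toℕ-combine l u) (cong (_+ toℕ u) (*-comm d (toℕ l)))))
           ([l*d+u]/d≡l (toℕ l) (Fin.toℕ<n u))))) ⟩
    ∑[ l < k ] ∑[ u < d ] f (toℕ l)
      ≡⟨ sum-cong-≗ {k} (λ l → sum-const d _) ⟩
    ∑[ l < k ] (d * f (toℕ l))
      ≡⟨ *-distribˡ-sum {k} d _ ⟨
    d * ∑[ l < k ] f (toℕ l)
      ∎

  rest : ∑[ u < ρ ] f (toℕ (k * d ↑ʳ u) / d) ≡ ρ * f k
  rest = trans
    (sum-cong-≗ (λ u → cong f (trans (/-congˡ (Fin.toℕ-↑ʳ (k * d) u))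
      ([l*d+u]/d≡l k (<-trans (Fin.toℕ<n u) (m%n<n q d))))))
    (sum-const ρ (f k))

-- Indicators

indicator : Bool → ℕ
indicator true  = 1
indicator false = 0

-- The factors are swapped so that the class indicator, second in `K ∩ class n q i`, comes first and
-- can be pulled out of an inner sum.
indicator-∧ : ∀ x y → indicator (x ∧ y) ≡ indicator y * indicator x
indicator-∧ true  true  = refl
indicator-∧ true  false = refl
indicator-∧ false true  = refl
indicator-∧ false false = refl

sum-indicator-unique : ∀ {p} {P : Pred (Fin n) p} (P? : Decidable P) {j} →
                       P j → (∀ {i} → P i → i ≡ j) → (f : Fin n → ℕ) →
                       ∑[ i < n ] (indicator (does (P? i)) * f i) ≡ f j
sum-indicator-unique {suc n} P? {j} Pj unique f = begin
  sum t                                        ≡⟨ sum-remove {i = j} t ⟩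
  t j + ∑[ i < n ] t (Fin.punchIn j i)         ≡⟨ cong₂ _+_ at-j (sum-zero off-j) ⟩
  f j + 0                                      ≡⟨ +-identityʳ (f j) ⟩
  f j                                          ∎
  where
  open ≡-Reasoning
  t = λ i → indicator (does (P? i)) * f i
  at-j : t j ≡ f j
  at-j rewrite dec-true (P? j) Pj = +-identityʳ (f j)
  off-j : ∀ i → t (Fin.punchIn j i) ≡ 0
  off-j i rewrite dec-false (P? (Fin.punchIn j i)) (Fin.punchInᵢ≢i j i ∘ unique) = refl

sum-indicator-one : ∀ {p} {P : Pred (Fin n) p} (P? : Decidable P) {j} →
                    P j → (∀ {i} → P i → i ≡ j) →
                    ∑[ i < n ] indicator (does (P? i)) ≡ 1
sum-indicator-one P? Pj unique = trans
  (sum-cong-≗ (λ i → sym (*-identityʳ (indicator (does (P? i))))))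
  (sum-indicator-unique P? Pj unique (λ _ → 1))

sum-indicator-≤1 : ∀ {p} {P : Pred (Fin n) p} (P? : Decidable P) →
                   (∀ {i j} → P i → P j → i ≡ j) →
                   ∑[ i < n ] indicator (does (P? i)) ≡ 0 ⊎ ∑[ i < n ] indicator (does (P? i)) ≡ 1
sum-indicator-≤1 P? unique with Fin.any? P?
... | yes (j , Pj) = inj₂ (sum-indicator-one P? Pj (λ Pi → unique Pi Pj))
... | no ∄P        = inj₁ (sum-zero (λ i → cong indicator (dec-false (P? i) (λ Pi → ∄P (i , Pi)))))

-- Cardinalities of subsets

∣p∣≡sum : (p : Subset n) → ∣ p ∣ ≡ ∑[ v < n ] indicator (lookup p v)
∣p∣≡sum []            = refl
∣p∣≡sum (inside  ∷ p) = cong suc (∣p∣≡sum p)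
∣p∣≡sum (outside ∷ p) = ∣p∣≡sum p

∣p∩a∣+∣∁p∩a∣≡∣a∣ : (p a : Subset n) → ∣ p ∩ a ∣ + ∣ ∁ p ∩ a ∣ ≡ ∣ a ∣
∣p∩a∣+∣∁p∩a∣≡∣a∣ []            []            = refl
∣p∩a∣+∣∁p∩a∣≡∣a∣ (inside  ∷ p) (inside  ∷ a) = cong suc (∣p∩a∣+∣∁p∩a∣≡∣a∣ p a)
∣p∩a∣+∣∁p∩a∣≡∣a∣ (inside  ∷ p) (outside ∷ a) = ∣p∩a∣+∣∁p∩a∣≡∣a∣ p a
∣p∩a∣+∣∁p∩a∣≡∣a∣ (outside ∷ p) (inside  ∷ a) = trans (+-suc ∣ p ∩ a ∣ _) (cong suc (∣p∩a∣+∣∁p∩a∣≡∣a∣ p a))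
∣p∩a∣+∣∁p∩a∣≡∣a∣ (outside ∷ p) (outside ∷ a) = ∣p∩a∣+∣∁p∩a∣≡∣a∣ p a

disjoint⇒∩∁ : (p l a : Subset n) → Empty (p ∩ l) → l ∩ a ≡ l ∩ (∁ p ∩ a)
disjoint⇒∩∁ []            []            []      _  = refl
disjoint⇒∩∁ (inside  ∷ p) (inside  ∷ l) (_ ∷ a) ¬∃ = contradiction (zero , here) ¬∃
disjoint⇒∩∁ (inside  ∷ p) (outside ∷ l) (_ ∷ a) ¬∃ =
  cong (outside ∷_) (disjoint⇒∩∁ p l a (λ (v , v∈) → ¬∃ (suc v , there v∈)))
disjoint⇒∩∁ (outside ∷ p) (_ ∷ l)       (_ ∷ a) ¬∃ =
  cong (_ ∷_) (disjoint⇒∩∁ p l a (λ (v , v∈) → ¬∃ (suc v , there v∈)))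

-- The set `a` is arbitrary so that the induction can replace it by `∁ K ∩ a`, the room that `K`
-- leaves for the other edges.
sum-disjoint-≤ : {M : List (Subset n)} → AllPairs (λ K L → Empty (K ∩ L)) M → (a : Subset n) →
                 ∑[ j < length M ] ∣ List.lookup M j ∩ a ∣ ≤ ∣ a ∣
sum-disjoint-≤ []                            a = z≤n
sum-disjoint-≤ {M = K ∷ M} (K#M ∷ disjoint) a = begin
  ∣ K ∩ a ∣ + ∑[ j < length M ] ∣ List.lookup M j ∩ a ∣
    ≡⟨ cong (∣ K ∩ a ∣ +_) (sum-cong-≗ (λ j →
         cong ∣_∣ (disjoint⇒∩∁ K (List.lookup M j) a (All.lookup K#M (∈-lookup j))))) ⟩
  ∣ K ∩ a ∣ + ∑[ j < length M ] ∣ List.lookup M j ∩ (∁ K ∩ a) ∣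
    ≤⟨ +-monoʳ-≤ ∣ K ∩ a ∣ (sum-disjoint-≤ disjoint (∁ K ∩ a)) ⟩
  ∣ K ∩ a ∣ + ∣ ∁ K ∩ a ∣
    ≡⟨ ∣p∩a∣+∣∁p∩a∣≡∣a∣ K a ⟩
  ∣ a ∣
    ∎
  where open ≤-Reasoning

-- Classes

module _ {n q : ℕ} where

  ∣∩class∣ : (K : Subset (n * q)) (i : Fin n) →
             ∣ K ∩ class n q i ∣ ≡ ∑[ p < q ] indicator (lookup K (combine i p))
  ∣∩class∣ K i = begin
    ∣ K ∩ class n q i ∣
      ≡⟨ ∣p∣≡sum (K ∩ class n q i) ⟩
    ∑[ v < n * q ] indicator (lookup (K ∩ class n q i) v)
      ≡⟨ sum-combine {n} _ ⟩
    ∑[ i′ < n ] ∑[ p < q ] indicator (lookup (K ∩ class n q i) (combine i′ p))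
      ≡⟨ sum-cong-≗ (λ i′ → sum-cong-≗ (λ p → pointwise i′ p)) ⟩
    ∑[ i′ < n ] ∑[ p < q ] (indicator (does (i′ Fin.≟ i)) * indicator (lookup K (combine i′ p)))
      ≡⟨ sum-cong-≗ {n} (λ i′ → sym (*-distribˡ-sum {q} (indicator (does (i′ Fin.≟ i))) _)) ⟩
    ∑[ i′ < n ] (indicator (does (i′ Fin.≟ i)) * ∑[ p < q ] indicator (lookup K (combine i′ p)))
      -- Of the double sum over all pairs, only the row `i′ = i` survives.
      ≡⟨ sum-indicator-unique (Fin._≟ i) refl (λ eq → eq) _ ⟩
    ∑[ p < q ] indicator (lookup K (combine i p))
      ∎
    where
    open ≡-Reasoning
    pointwise : ∀ i′ p → indicator (lookup (K ∩ class n q i) (combine i′ p)) ≡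
                         indicator (does (i′ Fin.≟ i)) * indicator (lookup K (combine i′ p))
    pointwise i′ p
      rewrite lookup-zipWith _∧_ (combine i′ p) K (class n q i)
            | lookup∘tabulate (λ v → does (quotient {n} q v Fin.≟ i)) (combine i′ p)
            | cong proj₁ (Fin.remQuot-combine i′ p)
      = indicator-∧ (lookup K (combine i′ p)) (does (i′ Fin.≟ i))

  ∣K∣≡sum-∩class : (K : Subset (n * q)) → ∣ K ∣ ≡ ∑[ i < n ] ∣ K ∩ class n q i ∣
  ∣K∣≡sum-∩class K = trans (∣p∣≡sum K) (trans (sum-combine {n} _) (sum-cong-≗ (λ i → sym (∣∩class∣ K i))))

  ∣class∣≤q : (i : Fin n) → ∣ class n q i ∣ ≤ q
  ∣class∣≤q i = begin
    ∣ class n q i ∣                                  ≡⟨ cong ∣_∣ (∩-identityˡ (class n q i)) ⟨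
    ∣ ⊤ ∩ class n q i ∣                              ≡⟨ ∣∩class∣ ⊤ i ⟩
    ∑[ p < q ] indicator (lookup ⊤ (combine i p))    ≤⟨ sum-mono-≤ {q} (λ p → indicator≤1 (lookup ⊤ (combine i p))) ⟩
    ∑[ p < q ] 1                                     ≡⟨ trans (sum-const q 1) (*-identityʳ q) ⟩
    q                                                ∎
    where
    open ≤-Reasoning
    indicator≤1 : ∀ b → indicator b ≤ 1
    indicator≤1 true  = ≤-refl
    indicator≤1 false = z≤n

-- Lists of intersection sizes

sum-nonZero : ∀ xs → ListAction.sum (filter (λ k → ¬? (k ≟ 0)) xs) ≡ ListAction.sum xs
sum-nonZero []           = refl
sum-nonZero (zero  ∷ xs) = sum-nonZero xs
sum-nonZero (suc x ∷ xs) = cong (suc x +_) (sum-nonZero xs)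

-- The discarded entries are zeros, and everything divides `0`.
∣-nonZero : ∀ {d} xs → All (d ∣_) (filter (λ k → ¬? (k ≟ 0)) xs) → All (d ∣_) xs
∣-nonZero []           _            = []
∣-nonZero (zero  ∷ xs) d∣xs         = (_ ∣0) ∷ ∣-nonZero xs d∣xs
∣-nonZero (suc x ∷ xs) (d∣x ∷ d∣xs) = d∣x ∷ ∣-nonZero xs d∣xs

nonZero-equal : ∀ {d xs} → All (λ x → x ≡ 0 ⊎ x ≡ d) xs → All (_≡ d) (filter (λ k → ¬? (k ≟ 0)) xs)
nonZero-equal []                                   = []
nonZero-equal {xs = zero  ∷ _} (_         ∷ xs≡)   = nonZero-equal xs≡
nonZero-equal {xs = suc _ ∷ _} (inj₂ x≡d  ∷ xs≡)   = x≡d ∷ nonZero-equal xs≡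

-- Since `d` is non-zero, the sum determines how many copies of `d` there are.
equal⇒replicate : ∀ {d s} .{{_ : NonZero d}} {xs} → All (_≡ d) xs → ListAction.sum xs ≡ s * d → xs ≡ replicate s d
equal⇒replicate {s = zero}  []            _  = refl
equal⇒replicate {d} {suc s} []            eq = contradiction (m+n≡0⇒m≡0 d (sym eq)) (≢-nonZero⁻¹ d)
equal⇒replicate {d} {zero}  (refl ∷ xs≡) eq = contradiction (m+n≡0⇒m≡0 d eq) (≢-nonZero⁻¹ d)
equal⇒replicate {d} {suc s} (refl ∷ xs≡) eq = cong (d ∷_) (equal⇒replicate xs≡ (+-cancelˡ-≡ d _ _ eq))

sum-tabulate : (f : Fin n → ℕ) → ListAction.sum (List.tabulate f) ≡ sum f
sum-tabulate {zero}  f = refl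
sum-tabulate {suc n} f = cong (f zero +_) (sum-tabulate (f ∘ suc))

sum-map-allFin : (f : Fin n → ℕ) → ListAction.sum (List.map f (allFin n)) ≡ sum f
sum-map-allFin f = trans (cong ListAction.sum (List.map-tabulate (λ i → i) f)) (sum-tabulate f)

-- Rounding down to multiples

m∸m%n≡m/n*n : ∀ m n .{{_ : NonZero n}} → m ∸ m % n ≡ m / n * n
m∸m%n≡m/n*n m n = trans (cong (_∸ m % n) (m≡m%n+[m/n]*n m n)) (m+n∸m≡n (m % n) (m / n * n))

∣⇒≤∸% : ∀ {m q d} .{{_ : NonZero d}} → d ∣ m → m ≤ q → m ≤ q ∸ q % d
∣⇒≤∸% {m} {q} {d} d∣m m≤q = begin
  m          ≡⟨ m/n*n≡m d∣m ⟨
  m / d * d  ≤⟨ *-monoˡ-≤ d (/-monoˡ-≤ d m≤q) ⟩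
  q / d * d  ≡⟨ m∸m%n≡m/n*n q d ⟨
  q ∸ q % d  ∎
  where open ≤-Reasoning

-- Edges

module _ (Δ s n q : ℕ) .{{_ : NonZero Δ}} where
  open UniformHypergraph (σ-hypergraph n (s * Δ) q (equalParts s Δ)) using (Edge)

  -- Divisibility is recorded instead of "`0` or `Δ`" because it survives summation over the edges
  -- of a matching.
  edge⇒∣ : ∀ K → Edge K → ∀ i → Δ ∣ ∣ K ∩ class n q i ∣
  edge⇒∣ K (_ , parts) i = All.tabulate⁻ (All.map⁻ (∣-nonZero _
    (All-resp-↭ (↭-sym parts) (All.replicate⁺ s ∣-refl)))) i

  edge⇒sum : ∀ K → Edge K → ∑[ i < n ] ∣ K ∩ class n q i ∣ ≡ s * Δ
  edge⇒sum K (∣K∣≡r , _) = trans (sym (∣K∣≡sum-∩class {n} {q} K)) ∣K∣≡r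

  -- The non-zero sizes are all `Δ`, and their total forces exactly `s` of them.
  edge⁺ : ∀ K → (∀ i → ∣ K ∩ class n q i ∣ ≡ 0 ⊎ ∣ K ∩ class n q i ∣ ≡ Δ) →
          ∑[ i < n ] ∣ K ∩ class n q i ∣ ≡ s * Δ → Edge K
  edge⁺ K sizes total =
    trans (∣K∣≡sum-∩class {n} {q} K) total ,
    ↭-reflexive (equal⇒replicate {Δ} {s} (nonZero-equal (All.map⁺ (All.tabulate⁺ sizes)))
      (trans (sum-nonZero (List.map (λ i → ∣ K ∩ class n q i ∣) (allFin n)))
        (trans (sum-map-allFin (λ i → ∣ K ∩ class n q i ∣)) total)))

  length-matching-≤ : ∀ {M} → IsMatching (σ-hypergraph n (s * Δ) q (equalParts s Δ)) M →
                      length M * (s * Δ) ≤ n * (q ∸ q % Δ)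
  length-matching-≤ {M} matching = begin
    length M * (s * Δ)
      ≡⟨ sum-const (length M) (s * Δ) ⟨
    ∑[ j < length M ] (s * Δ)
      ≡⟨ sum-cong-≗ (λ j → edge⇒sum (List.lookup M j) (edge j)) ⟨
    ∑[ j < length M ] ∑[ i < n ] ∣ List.lookup M j ∩ class n q i ∣
      ≡⟨ ∑-comm (λ j i → ∣ List.lookup M j ∩ class n q i ∣) ⟩
    ∑[ i < n ] ∑[ j < length M ] ∣ List.lookup M j ∩ class n q i ∣
      -- The rounding to a multiple of `Δ` must happen within each class, before summing over the
      -- classes.
      ≤⟨ sum-mono-≤ (λ i → ∣⇒≤∸% (∣-sum (λ j → edge⇒∣ (List.lookup M j) (edge j) i))
           (≤-trans (sum-disjoint-≤ disjoint (class n q i)) (∣class∣≤q i))) ⟩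
    ∑[ i < n ] (q ∸ q % Δ)
      ≡⟨ sum-const n (q ∸ q % Δ) ⟩
    n * (q ∸ q % Δ)
      ∎
    where
    open ≤-Reasoning
    open IsMatching matching
    edge : ∀ j → Edge (List.lookup M j)
    edge j = All.lookup edges (∈-lookup j)

-- Consecutive blocks

module _ (Δ s n q : ℕ) .{{_ : NonZero Δ}} .{{_ : NonZero s}} (s≤n : s ≤ n) where
  open UniformHypergraph (σ-hypergraph n (s * Δ) q (equalParts s Δ)) using (Edge)

  -- The block number of a vertex, divided by `s`. Leftover vertices are treated as a level `q / Δ`
  -- of incomplete blocks, so they get numbers of at least `n * (q / Δ)`.
  group : Fin (n * q) → ℕ
  group v = (n * (toℕ (remainder {n} q v) / Δ) + toℕ (quotient {n} q v)) / s

  -- As level sets of one function, these are disjoint for distinct `j`.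
  groupEdge : ℕ → Subset (n * q)
  groupEdge j = tabulate (λ v → does (group v ≟ j))

  ∈groupEdge⇒ : ∀ {j v} → v ∈ groupEdge j → group v ≡ j
  ∈groupEdge⇒ {j} {v} v∈ = does-true (group v ≟ j)
    (trans (sym (lookup∘tabulate (λ v → does (group v ≟ j)) v)) ([]=⇒lookup v∈))
    where
    does-true : ∀ {A : Set} (A? : Dec A) → does A? ≡ true → A
    does-true (yes a) _ = a

  groupEdge-disjoint : ∀ {j k} → j ≢ k → Empty (groupEdge j ∩ groupEdge k)
  groupEdge-disjoint {j} {k} j≢k (v , v∈) with v∈j , v∈k ← x∈p∩q⁻ (groupEdge j) (groupEdge k) v∈ =
    j≢k (trans (sym (∈groupEdge⇒ v∈j)) (∈groupEdge⇒ v∈k))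

  private
    inGroup : ℕ → ℕ → ℕ
    inGroup j t = indicator (does (t / s ≟ j))

  -- One level up in a class raises the block number by `n`, hence by at least `s`, so the quotient
  -- by `s` grows by at least one.
  l<l′⇒group≢ : ∀ i {l l′} → l < l′ → (n * l + i) / s ≢ (n * l′ + i) / s
  l<l′⇒group≢ i {l} {l′} l<l′ = <⇒≢ (begin-strict
    (n * l + i) / s          <⟨ n<1+n _ ⟩
    1 + (n * l + i) / s      ≡⟨ cong (_+ (n * l + i) / s) (n/n≡1 s) ⟨
    s / s + (n * l + i) / s  ≡⟨ +-distrib-/-∣ˡ (n * l + i) ∣-refl ⟨
    (s + (n * l + i)) / s    ≤⟨ /-monoˡ-≤ s (begin
        s + (n * l + i)        ≤⟨ +-monoˡ-≤ (n * l + i) s≤n ⟩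
        n + (n * l + i)        ≡⟨ +-assoc n (n * l) i ⟨
        n + n * l + i          ≡⟨ cong (_+ i) (*-suc n l) ⟨
        n * suc l + i          ≤⟨ +-monoˡ-≤ i (*-monoʳ-≤ n l<l′) ⟩
        n * l′ + i             ∎) ⟩
    (n * l′ + i) / s         ∎)
    where open ≤-Reasoning

  sameGroup⇒≡ : ∀ i {l l′} → (n * l + i) / s ≡ (n * l′ + i) / s → l ≡ l′
  sameGroup⇒≡ i {l} {l′} eq with <-cmp l l′
  ... | tri< l<l′ _ _ = contradiction eq (l<l′⇒group≢ i l<l′)
  ... | tri≈ _ l≡l′ _ = l≡l′
  ... | tri> _ _ l>l′ = contradiction (sym eq) (l<l′⇒group≢ i l>l′)

  module _ {j : ℕ} (j<k : j < q / Δ * n / s) where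

    -- All `Δ` vertices of a block share one group, so the blocks of class `i` that lie in group `j`
    -- are counted `Δ` times.
    ∣groupEdge∩class∣ : ∀ i → ∣ groupEdge j ∩ class n q i ∣ ≡
                              Δ * ∑[ l < q / Δ ] inGroup j (n * toℕ l + toℕ i)
    ∣groupEdge∩class∣ i = begin
      ∣ groupEdge j ∩ class n q i ∣
        ≡⟨ ∣∩class∣ (groupEdge j) i ⟩
      ∑[ p < q ] indicator (lookup (groupEdge j) (combine i p))
        ≡⟨ sum-cong-≗ pointwise ⟩
      ∑[ p < q ] inGroup j (n * (toℕ p / Δ) + toℕ i)
        ≡⟨ sum-quotient q Δ (λ l → inGroup j (n * l + toℕ i)) ⟩
      Δ * ∑[ l < q / Δ ] inGroup j (n * toℕ l + toℕ i) + q % Δ * inGroup j (n * (q / Δ) + toℕ i)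
        ≡⟨ m+n≡m (trans (cong (q % Δ *_) leftover) (*-zeroʳ (q % Δ))) ⟩
      Δ * ∑[ l < q / Δ ] inGroup j (n * toℕ l + toℕ i)
        ∎
      where
      open ≡-Reasoning
      m+n≡m : ∀ {m n} → n ≡ 0 → m + n ≡ m
      m+n≡m refl = +-identityʳ _
      pointwise : ∀ p → indicator (lookup (groupEdge j) (combine i p)) ≡
                        inGroup j (n * (toℕ p / Δ) + toℕ i)
      pointwise p
        rewrite lookup∘tabulate (λ v → does (group v ≟ j)) (combine i p)
              | cong proj₁ (Fin.remQuot-combine i p)
              | cong proj₂ (Fin.remQuot-combine i p)
        = refl
      leftover : inGroup j (n * (q / Δ) + toℕ i) ≡ 0
      -- Leftover vertices have group at least `q / Δ * n / s`, which exceeds `j`.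
      leftover = cong indicator (dec-false (_ ≟ j) (>⇒≢ (<-≤-trans j<k
        (/-monoˡ-≤ s (≤-trans (≤-reflexive (*-comm (q / Δ) n)) (m≤m+n _ (toℕ i)))))))

    groupEdge-isEdge : Edge (groupEdge j)
    groupEdge-isEdge = edge⁺ Δ s n q (groupEdge j) sizes total
      where
      open ≡-Reasoning
      sizes : ∀ i → ∣ groupEdge j ∩ class n q i ∣ ≡ 0 ⊎ ∣ groupEdge j ∩ class n q i ∣ ≡ Δ
      -- Blocks of one class lie in distinct groups, so at most one of them is in group `j`.
      sizes i with sum-indicator-≤1 (λ (l : Fin (q / Δ)) → (n * toℕ l + toℕ i) / s ≟ j)
                     (λ eq eq′ → Fin.toℕ-injective (sameGroup⇒≡ (toℕ i) (trans eq (sym eq′))))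
      ... | inj₁ ≡0 = inj₁ (trans (∣groupEdge∩class∣ i) (trans (cong (Δ *_) ≡0) (*-zeroʳ Δ)))
      ... | inj₂ ≡1 = inj₂ (trans (∣groupEdge∩class∣ i) (trans (cong (Δ *_) ≡1) (*-identityʳ Δ)))

      blocks : ∑[ t < q / Δ * n ] inGroup j (toℕ t) ≡ s
      blocks = begin
        ∑[ t < q / Δ * n ] inGroup j (toℕ t)
          -- Group `j` is one of the complete groups, and the possible incomplete last group has
          -- index `q / Δ * n / s`.
          ≡⟨ sum-quotient (q / Δ * n) s (λ c → indicator (does (c ≟ j))) ⟩
        s * ∑[ c < q / Δ * n / s ] indicator (does (toℕ c ≟ j))
          + (q / Δ * n) % s * indicator (does (q / Δ * n / s ≟ j))
          ≡⟨ cong₂ (λ x y → s * x + (q / Δ * n) % s * y)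
               (sum-indicator-one (λ c → toℕ c ≟ j) (Fin.toℕ-fromℕ< j<k)
                 (λ eq → Fin.toℕ-injective (trans eq (sym (Fin.toℕ-fromℕ< j<k)))))
               (cong indicator (dec-false (_ ≟ j) (>⇒≢ j<k))) ⟩
        s * 1 + (q / Δ * n) % s * 0
          ≡⟨ cong₂ _+_ (*-identityʳ s) (*-zeroʳ ((q / Δ * n) % s)) ⟩
        s + 0
          ≡⟨ +-identityʳ s ⟩
        s
          ∎

      total : ∑[ i < n ] ∣ groupEdge j ∩ class n q i ∣ ≡ s * Δ
      total = begin
        ∑[ i < n ] ∣ groupEdge j ∩ class n q i ∣
          ≡⟨ sum-cong-≗ ∣groupEdge∩class∣ ⟩
        ∑[ i < n ] (Δ * ∑[ l < q / Δ ] inGroup j (n * toℕ l + toℕ i))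
          ≡⟨ *-distribˡ-sum {n} Δ _ ⟨
        Δ * ∑[ i < n ] ∑[ l < q / Δ ] inGroup j (n * toℕ l + toℕ i)
          -- With the level `l` outermost, `n * l + i` is the value of `combine l i`, so the double
          -- sum runs once through all block numbers below `q / Δ * n`.
          ≡⟨ cong (Δ *_) (∑-comm {n} {q / Δ} _) ⟩
        Δ * ∑[ l < q / Δ ] ∑[ i < n ] inGroup j (n * toℕ l + toℕ i)
          ≡⟨ cong (Δ *_) (sum-cong-≗ {q / Δ} (λ l → sum-cong-≗ {n} (λ i → cong (inGroup j) (Fin.toℕ-combine l i)))) ⟨
        Δ * ∑[ l < q / Δ ] ∑[ i < n ] inGroup j (toℕ (combine l i))
          ≡⟨ cong (Δ *_) (sum-combine {q / Δ} {n} (λ t → inGroup j (toℕ t))) ⟨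
        Δ * ∑[ t < q / Δ * n ] inGroup j (toℕ t)
          ≡⟨ cong (Δ *_) blocks ⟩
        Δ * s
          ≡⟨ *-comm Δ s ⟩
        s * Δ
          ∎

  groupMatching : List (Subset (n * q))
  groupMatching = List.tabulate {n = q / Δ * n / s} (groupEdge ∘ toℕ)

  groupMatching-isMatching : IsMatching (σ-hypergraph n (s * Δ) q (equalParts s Δ)) groupMatching
  groupMatching-isMatching = record
    { edges    = All.tabulate⁺ (λ j → groupEdge-isEdge (Fin.toℕ<n j))
    ; distinct = AllPairs.tabulate⁺ distinct
    ; disjoint = AllPairs.tabulate⁺ (λ j≢k → groupEdge-disjoint (j≢k ∘ Fin.toℕ-injective))
    }
    where
    distinct : ∀ {j k : Fin (q / Δ * n / s)} → j ≢ k → groupEdge (toℕ j) ≢ groupEdge (toℕ k)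
    -- Equal groups with different indices would be disjoint from themselves, hence empty, whereas
    -- an edge has `s * Δ` vertices.
    distinct {j} {k} j≢k eq = ≢-nonZero⁻¹ (s * Δ) {{m*n≢0 s Δ}} (begin
      s * Δ                                     ≡⟨ proj₁ (groupEdge-isEdge (Fin.toℕ<n j)) ⟨
      ∣ groupEdge (toℕ j) ∣                     ≡⟨ cong ∣_∣ (∩-idem (groupEdge (toℕ j))) ⟨
      ∣ groupEdge (toℕ j) ∩ groupEdge (toℕ j) ∣ ≡⟨ cong (λ K → ∣ groupEdge (toℕ j) ∩ K ∣) eq ⟩
      ∣ groupEdge (toℕ j) ∩ groupEdge (toℕ k) ∣
        ≡⟨ cong ∣_∣ (Empty-unique (groupEdge-disjoint (j≢k ∘ Fin.toℕ-injective))) ⟩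
      _                                         ≡⟨ ∣⊥∣≡0 (n * q) ⟩
      0                                         ∎)
      where open ≡-Reasoning

-- The matching number as a rounded quotient

theorem3p7 : ∀ (Δ s n q : ℕ) .{{_ : NonZero Δ}} .{{_ : NonZero s}} →
    let r = s * Δ in
    n ≥ (r + 1) ^ 2 → q ≥ r * Δ →
    IsMatchingNumber (σ-hypergraph n r q (equalParts s Δ))
    (_/_ (n * (q ∸ q % Δ)) r {{m*n≢0 s Δ}})
theorem3p7 Δ s n q n≥ _ = record
  { attained = groupMatching Δ s n q s≤n , groupMatching-isMatching Δ s n q s≤n ,
               trans (List.length-tabulate _) count
  ; maximal  = λ M matching → begin
      length M                      ≡⟨ m*n/n≡m (length M) (s * Δ) ⟨
      length M * (s * Δ) / (s * Δ)  ≤⟨ /-monoˡ-≤ (s * Δ) (length-matching-≤ Δ s n q matching) ⟩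
      n * (q ∸ q % Δ) / (s * Δ)     ∎
  }
  where
  open ≤-Reasoning
  instance
    r≢0 : NonZero (s * Δ)
    r≢0 = m*n≢0 s Δ

  s≤n : s ≤ n
  s≤n = begin
    s                ≤⟨ m≤m*n s Δ ⟩
    s * Δ            ≤⟨ m≤m+n (s * Δ) 1 ⟩
    -- The second factor has the shape to which `(s * Δ + 1) ^ 2` unfolds.
    s * Δ + 1        ≤⟨ m≤m*n (s * Δ + 1) ((s * Δ + 1) * 1) {{m*n≢0 (s * Δ + 1) 1 {{r+1≢0}}}} ⟩
    (s * Δ + 1) ^ 2  ≤⟨ n≥ ⟩
    n                ∎
    where
    r+1≢0 : NonZero (s * Δ + 1)
    r+1≢0 = >-nonZero (m≤n+m 1 (s * Δ))

  count : q / Δ * n / s ≡ n * (q ∸ q % Δ) / (s * Δ)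
  count = begin-equality
    q / Δ * n / s                ≡⟨ cong (_/ s) (*-comm (q / Δ) n) ⟩
    -- Expanding the fraction by `Δ` leaves its integer part unchanged and produces `q / Δ * Δ`.
    n * (q / Δ) / s              ≡⟨ m*n/o*n≡m/o (n * (q / Δ)) Δ s ⟨
    n * (q / Δ) * Δ / (s * Δ)    ≡⟨ cong (_/ (s * Δ)) (*-assoc n (q / Δ) Δ) ⟩
    n * (q / Δ * Δ) / (s * Δ)    ≡⟨ cong (λ x → n * x / (s * Δ)) (m∸m%n≡m/n*n q Δ) ⟨
    n * (q ∸ q % Δ) / (s * Δ)    ∎
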